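{- For every integer $t \ge 8$, the integer $4t+4$ is a magic constant.
   Context: All graphs $G=(V,E)$ are finite, simple (undirected, no loops or multiple edges), with nonempty vertex set, and not necessarily connected. A positive integer $k$ is called a magic constant if there exist a graph $G=(V,E)$ and a bijection $f: V \to \{1,2,\dots,|V|\}$ such that for every vertex $v \in V$ the weight $w(v) = \sum_{u \in N(v)} f(u)$ equals $k$, where $N(v) = \{u \in V : uv \in E\}$ is the (open) neighborhood of $v$. -}

module Defs where

open import Data.Fin.Base using (Fin; toℕ)
open import Data.List.Base using (List; allFin; filter; map)
open import Data.Nat.Base using (ℕ; suc; _>_)
open import Data.Nat.ListAction using (sum)
open import Data.Product.Base using (_×_; Σ-syntax)
open import Function.Bundles using (_⤖_; Bijection)
open import Level using (0ℓ)
open import Relation.Binary.Core using (Rel)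
open import Relation.Binary.Definitions using (Decidable; Irreflexive; Symmetric)
open import Relation.Binary.PropositionalEquality.Core using (_≡_)

-- Finite simple graphs with nonempty vertex set.  A finite vertex set is taken
-- to be Fin order, and adjacency is decidable so that neighbourhoods can be
-- enumerated.
record Graph : Set₁ where
  field
    order    : ℕ
    nonEmpty : order > 0

  Vertex : Set
  Vertex = Fin order

  field
    Adjacent   : Rel Vertex 0ℓ
    adjacent?  : Decidable Adjacent
    symmetric  : Symmetric Adjacent
    loopless   : Irreflexive _≡_ Adjacent

  -- The open neighbourhood, listed without repetition.
  N : Vertex → List Vertex
  N v = filter (adjacent? v) (allFin order)

  -- Bijections from the vertices to {1, …, order}: the element i of the
  -- codomain Fin order stands for the label 1 + toℕ i.
  Labelling : Set
  Labelling = Vertex ⤖ Fin order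

  label : Labelling → Vertex → ℕ
  label f v = suc (toℕ (Bijection.to f v))

  weight : Labelling → Vertex → ℕ
  weight f v = sum (map (label f) (N v))

IsMagicConstant : ℕ → Set₁
IsMagicConstant k =
  k > 0 × (Σ[ G ∈ Graph ] let open Graph G in
    Σ[ f ∈ Labelling ] (∀ (v : Vertex) → weight f v ≡ k))

{-# OPTIONS --safe #-}
module Submission where

-- The graph is 4-regular on the labels 1, …, 2t + 1, so subtracting t + 1 from
-- every label turns the claim into: the neighbours of each vertex sum to 0.
-- A fixed gadget on {−8, …, 8}, found by computer search, has neighbour sums 0
-- and degree 4, except that ±8 and ±6 have degree 2.  Joining consecutive
-- antipodal pairs completely along ±8, ±9, …, ±t, ±6 supplies the missing
-- degrees and contributes 0 to every neighbour sum.

open import Defs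
open import Data.Nat.Base using (ℕ; zero; suc; _+_; _*_; _∸_; _≥_; _>_; z<s)
open import Data.Nat.ListAction using (sum)
open import Data.Nat.ListAction.Properties using (sum-↭; sum-++)
open import Data.Nat.Properties using (1+n≢n; m≤n⇒∃[o]m+o≡n; m∸n+n≡m)
import Data.Nat.Properties as ℕ
open import Data.Nat.Tactic.RingSolver using (solve-∀)
open import Data.Bool.Base using (Bool; true; false)
import Data.Bool.Properties as Bool
open import Data.Fin using (#_)
open import Data.Fin.Base
  using (Fin; zero; suc; toℕ; fromℕ; inject₁; opposite; _↑ˡ_; _↑ʳ_)
open import Data.Fin.Patterns using (0F; 1F)
open import Data.Fin.Properties
  using (all?; +↔⊎; opposite-prop; opposite-involutive; toℕ-inject₁; toℕ-fromℕ
        ; toℕ-↑ˡ; toℕ-↑ʳ; toℕ≤pred[n])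
import Data.Fin.Properties as Fin
open import Data.Fin.Relation.Unary.Top
  using (View; view; view-fromℕ; view-inject₁; ‵fromℕ; ‵inject₁)
open import Data.List.Base using (List; []; _∷_; _++_; map; filter; allFin)
open import Data.List.Membership.Propositional using (_∈_; _∉_)
open import Data.List.Membership.Propositional.Properties
  using (∈-map⁺; ∈-map⁻; ∈-++⁺ˡ; ∈-++⁺ʳ; ∈-++⁻; ∈-filter⁺; ∈-filter⁻; ∈-allFin)
open import Data.List.Membership.Propositional.Properties.WithK using (unique∧set⇒bag)
open import Data.List.Properties using (map-∘; map-cong; map-++)
open import Data.List.Relation.Binary.BagAndSetEquality using (∼bag⇒↭)
open import Data.List.Relation.Binary.Permutation.Propositional using (_↭_)
import Data.List.Relation.Binary.Permutation.Propositional.Properties as Perm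
open import Data.List.Relation.Unary.All as All using (All; []; _∷_)
open import Data.List.Relation.Unary.AllPairs using ([]; _∷_)
open import Data.List.Relation.Unary.Any using (here; there)
open import Data.List.Relation.Unary.Unique.Propositional using (Unique)
import Data.List.Relation.Unary.Unique.Propositional.Properties as Unique
import Data.List.Relation.Unary.Unique.DecPropositional as DecUnique
import Data.List.Membership.DecPropositional as DecMembership
open import Data.Product.Base using (_×_; _,_; proj₁; proj₂; map₂; ∃-syntax)
import Data.Product.Properties as Product
open import Data.Sum.Base as Sum using (_⊎_; inj₁; inj₂)
import Data.Sum.Properties as Sum
open import Data.Sum.Function.Propositional using (_⊎-cong_)
open import Data.Vec.Base using ([]; _∷_; lookup)
open import Function.Base using (_∘_; _$_)
open import Function.Bundles using (_↔_; Inverse; mk↔ₛ′; mk⇔)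
open import Function.Construct.Identity using (⤖-id; ↔-id)
open import Function.Properties.Inverse using (↔-sym; ↔-trans)
open import Relation.Binary.Definitions using (DecidableEquality)
open import Relation.Binary.PropositionalEquality
open import Relation.Nullary.Decidable using (Dec; True; from-yes; toWitness; ¬?)
open import Relation.Unary using (Decidable)

-- From neighbour lists to a labelled graph.

-- Both lists are duplicate-free with the same members, hence equal as bags. Weights can thus be
-- summed over a given list instead of the filtered enumeration.
filter-∈-allFin : ∀ {n} {xs : List (Fin n)} → Unique xs →
                  filter (λ i → DecMembership._∈?_ Fin._≟_ i xs) (allFin n) ↭ xs
filter-∈-allFin {n} xs! = ∼bag⇒↭ $ unique∧set⇒bag
  (Unique.filter⁺ _ (Unique.allFin⁺ n)) xs!
  (mk⇔ (proj₂ ∘ ∈-filter⁻ _ {xs = allFin n}) (∈-filter⁺ _ (∈-allFin _)))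

module _ {n} {V : Set} (enum : V ↔ Fin n) (nbrs : V → List V) where

  open Inverse enum

  -- The graph is transported along `enum` to `Fin n`, where each vertex is its own label up to the
  -- shift by one and the identity serves as labelling.
  neighbourLists⇒magic :
    ∀ {k} → n > 0 → k > 0 →
    (∀ v → Unique (nbrs v)) →
    (∀ u v → v ∈ nbrs u → u ∈ nbrs v) →
    (∀ v → v ∉ nbrs v) →
    (∀ v → sum (map (suc ∘ toℕ ∘ to) (nbrs v)) ≡ k) →
    IsMagicConstant k
  neighbourLists⇒magic {k} n>0 k>0 nbrs! nbrs-sym nbrs-irrefl nbrs-sum =
    k>0 , G , ⤖-id _ , weight≡k
    where
    nbrsᶠ : Fin n → List (Fin n)
    nbrsᶠ i = map to (nbrs (from i))

    ∈-nbrsᶠ⁻ : ∀ {i j} → j ∈ nbrsᶠ i → from j ∈ nbrs (from i)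
    ∈-nbrsᶠ⁻ {i} j∈ with v , v∈ , refl ← ∈-map⁻ to j∈ =
      subst (_∈ nbrs (from i)) (sym (strictlyInverseʳ v)) v∈

    ∈-nbrsᶠ⁺ : ∀ {i j} → from j ∈ nbrs (from i) → j ∈ nbrsᶠ i
    ∈-nbrsᶠ⁺ {i} {j} j∈ =
      subst (_∈ nbrsᶠ i) (strictlyInverseˡ j) (∈-map⁺ to j∈)

    G : Graph
    G = record
      { order     = n
      ; nonEmpty  = n>0
      ; Adjacent  = λ i j → j ∈ nbrsᶠ i
      ; adjacent? = λ i j → DecMembership._∈?_ Fin._≟_ j (nbrsᶠ i)
      ; symmetric = λ j∈ → ∈-nbrsᶠ⁺ (nbrs-sym _ _ (∈-nbrsᶠ⁻ j∈))
      ; loopless  = λ { refl i∈ → nbrs-irrefl _ (∈-nbrsᶠ⁻ i∈) }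
      }

    to-injective : ∀ {u v} → to u ≡ to v → u ≡ v
    to-injective {u} {v} eq =
      trans (sym (strictlyInverseʳ u)) (trans (cong from eq) (strictlyInverseʳ v))

    weight≡k : ∀ i → Graph.weight G (⤖-id _) i ≡ k
    weight≡k i = begin
      sum (map (suc ∘ toℕ) (Graph.N G i))
        ≡⟨ sum-↭ (Perm.map⁺ _ (filter-∈-allFin (Unique.map⁺ to-injective (nbrs! (from i))))) ⟩
      sum (map (suc ∘ toℕ) (map to (nbrs (from i))))
        ≡⟨ cong sum (map-∘ (nbrs (from i))) ⟨
      sum (map (suc ∘ toℕ ∘ to) (nbrs (from i)))
        ≡⟨ nbrs-sum (from i) ⟩
      k ∎
      where open ≡-Reasoning

-- Vertices and labels.

-- With p = t − 7 and labels shifted by t + 1, core c stands for c − 7, low i for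
-- −(8 + i) and high i for 8 + i.
Vertex : ℕ → Set
Vertex p = Fin 15 ⊎ (Bool × Fin p)

pattern core c   = inj₁ c
pattern side s i = inj₂ (s , i)
pattern low i    = side false i
pattern high i   = side true i

_≟_ : ∀ {p} → DecidableEquality (Vertex p)
_≟_ = Sum.≡-dec Fin._≟_ (Product.≡-dec Bool._≟_ Fin._≟_)

-- `opposite` reverses the low side because levels run outwards from the core: the larger `i`, the
-- smaller the label of `low i`.
byLabel : ∀ p → Vertex p ↔ Fin (p + (15 + p))
byLabel p = ↔-trans (mk↔ₛ′ to from to∘from from∘to)
                    (↔-sym (↔-trans +↔⊎ (↔-id _ ⊎-cong +↔⊎)))
  where
  to : Vertex p → Fin p ⊎ (Fin 15 ⊎ Fin p)
  to (core c) = inj₂ (inj₁ c)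
  to (low i)  = inj₁ (opposite i)
  to (high i) = inj₂ (inj₂ i)

  from : Fin p ⊎ (Fin 15 ⊎ Fin p) → Vertex p
  from (inj₁ i)        = low (opposite i)
  from (inj₂ (inj₁ c)) = core c
  from (inj₂ (inj₂ i)) = high i

  to∘from : ∀ x → to (from x) ≡ x
  to∘from (inj₁ i)        = cong inj₁ (opposite-involutive i)
  to∘from (inj₂ (inj₁ c)) = refl
  to∘from (inj₂ (inj₂ i)) = refl

  from∘to : ∀ v → from (to v) ≡ v
  from∘to (core c) = refl
  from∘to (low i)  = cong (λ i → low i) (opposite-involutive i)
  from∘to (high i) = refl

label : ∀ {p} → Vertex p → ℕ
label {p} v = suc (toℕ (Inverse.to (byLabel p) v))

label-core : ∀ {p} c → label {p} (core c) ≡ suc (p + toℕ c)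
label-core {p} c = cong suc (trans (toℕ-↑ʳ p (c ↑ˡ p)) (cong (p +_) (toℕ-↑ˡ c p)))

label-low : ∀ {m} (i : Fin (suc m)) → label (low i) ≡ suc (m ∸ toℕ i)
label-low {m} i = cong suc (trans (toℕ-↑ˡ (opposite i) (15 + suc m)) (opposite-prop i))

label-high : ∀ {p} (i : Fin p) → label (high i) ≡ suc (p + (15 + toℕ i))
label-high {p} i = cong suc (trans (toℕ-↑ʳ p (15 ↑ʳ i)) (cong (p +_) (toℕ-↑ʳ 15 i)))

pair : ∀ {p} → Fin p → List (Vertex p)
pair i = low i ∷ high i ∷ []

-- The two vertices of a level are antipodal, so their labels add up to 2(t + 1), where t = m + 8.
pair-sum : ∀ {m} (i : Fin (suc m)) → sum (map label (pair i)) ≡ 18 + 2 * m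
pair-sum {m} i = begin
  label (low i) + (label (high i) + 0)
    ≡⟨ cong₂ (λ a b → a + (b + 0)) (label-low i) (label-high i) ⟩
  suc (m ∸ toℕ i) + (suc (suc m + (15 + toℕ i)) + 0)
    ≡⟨ regroup (m ∸ toℕ i) (toℕ i) m ⟩
  18 + m + (m ∸ toℕ i + toℕ i)
    ≡⟨ cong (18 + m +_) (m∸n+n≡m (toℕ≤pred[n] i)) ⟩
  18 + m + m
    ≡⟨ double m ⟩
  18 + 2 * m ∎
  where
  open ≡-Reasoning
  regroup : ∀ d i m → suc d + (suc (suc m + (15 + i)) + 0) ≡ 18 + m + (d + i)
  regroup = solve-∀
  double : ∀ m → 18 + m + m ≡ 18 + 2 * m
  double = solve-∀

-- Neighbour lists.

-- Vertex 2 serves as a template: its levels 0 and 1 stand for the first and the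
-- last level, so that everything about the core reduces to finite checks.
Template : Set
Template = Vertex 2

-- For `m = 0` the two levels coincide, and `place` is then not injective.
level : ∀ {m} → Fin 2 → Fin (suc m)
level     0F = zero
level {m} 1F = fromℕ m

place : ∀ {m} → Template → Vertex (suc m)
place = Sum.map₂ (map₂ level)

-- Row `c` lists the gadget edges at c - 7; the entries of level `1F`, in rows 1 and 13 only, attach
-- -6 and 6 to the far end ±t of the chain.
coreNbrs : Fin 15 → List Template
coreNbrs = lookup
  ( (core (# 4) ∷ core (# 7) ∷ core (# 8) ∷ core (# 9) ∷ [])
  ∷ (core (# 2) ∷ core (# 12) ∷ low 1F ∷ high 1F ∷ [])
  ∷ (core (# 1) ∷ core (# 6) ∷ core (# 9) ∷ core (# 12) ∷ [])
  ∷ (low 0F ∷ core (# 5) ∷ core (# 10) ∷ core (# 14) ∷ [])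
  ∷ (core (# 0) ∷ core (# 5) ∷ core (# 10) ∷ core (# 13) ∷ [])
  ∷ (core (# 3) ∷ core (# 4) ∷ core (# 6) ∷ high 0F ∷ [])
  ∷ (core (# 2) ∷ core (# 5) ∷ core (# 7) ∷ core (# 14) ∷ [])
  ∷ (core (# 0) ∷ core (# 6) ∷ core (# 8) ∷ core (# 14) ∷ [])
  ∷ (core (# 0) ∷ core (# 7) ∷ core (# 10) ∷ core (# 11) ∷ [])
  ∷ (core (# 0) ∷ core (# 2) ∷ core (# 11) ∷ high 0F ∷ [])
  ∷ (core (# 3) ∷ core (# 4) ∷ core (# 8) ∷ core (# 13) ∷ [])
  ∷ (low 0F ∷ core (# 8) ∷ core (# 9) ∷ core (# 12) ∷ [])
  ∷ (core (# 1) ∷ core (# 2) ∷ core (# 11) ∷ core (# 14) ∷ [])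
  ∷ (core (# 4) ∷ core (# 10) ∷ low 1F ∷ high 1F ∷ [])
  ∷ (core (# 3) ∷ core (# 6) ∷ core (# 7) ∷ core (# 12) ∷ [])
  ∷ [] )

-- Each list is an antipodal pair: ±4 for -8, ±2 for 8, and ±6 at the far end.
endNbrs : Bool → Fin 2 → List (Fin 15)
endNbrs _     1F = # 1 ∷ # 13 ∷ []
endNbrs false 0F = # 3 ∷ # 11 ∷ []
endNbrs true  0F = # 5 ∷ # 9 ∷ []

below : ∀ {m} → Bool → Fin (suc m) → List (Vertex (suc m))
below s zero    = map inj₁ (endNbrs s 0F)
below s (suc i) = pair (inject₁ i)

-- The view is an argument so that proofs can split on whether the level is the last.
above : ∀ {m} → Bool → {i : Fin (suc m)} → View i → List (Vertex (suc m))
above s ‵fromℕ       = map inj₁ (endNbrs s 1F)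
above s (‵inject₁ i) = pair (suc i)

nbrs : ∀ {m} → Vertex (suc m) → List (Vertex (suc m))
nbrs (core c)   = map place (coreNbrs c)
nbrs (side s i) = below s i ++ above s (view i)

-- Symmetry.

-- The back edge is phrased on templates, without `m`, so that symmetry at the core becomes a finite
-- check.
CoreNbrOf : Fin 15 → Template → Set
CoreNbrOf c (core d)   = core c ∈ coreNbrs d
CoreNbrOf c (side s e) = c ∈ endNbrs s e

coreNbrs-sym : ∀ c → All (CoreNbrOf c) (coreNbrs c)
coreNbrs-sym = from-yes (all? λ c → All.all? (coreNbrOf? c) (coreNbrs c))
  where
  coreNbrOf? : ∀ c → Decidable (CoreNbrOf c)
  coreNbrOf? c (core d)   = DecMembership._∈?_ _≟_ (core c) (coreNbrs d)
  coreNbrOf? c (side s e) = DecMembership._∈?_ Fin._≟_ c (endNbrs s e)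

endNbrs-sym : ∀ s e → All (λ c → side s e ∈ coreNbrs c) (endNbrs s e)
endNbrs-sym = λ where
    false → from-yes (all? (check? false))
    true  → from-yes (all? (check? true))
  where
  check? : ∀ s e → Dec (All (λ c → side s e ∈ coreNbrs c) (endNbrs s e))
  check? s e = All.all? (λ c → DecMembership._∈?_ _≟_ (side s e) (coreNbrs c)) (endNbrs s e)

coreNbrs-irrefl : ∀ c → core c ∉ coreNbrs c
coreNbrs-irrefl = from-yes (all? λ c → ¬? (DecMembership._∈?_ _≟_ (core c) (coreNbrs c)))

∈-pair : ∀ {p} s (i : Fin p) → side s i ∈ pair i
∈-pair false i = here refl
∈-pair true  i = there (here refl)

∈-pair⁻ : ∀ {p} {i : Fin p} {v} → v ∈ pair i → ∃[ s ] v ≡ side s i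
∈-pair⁻ (here eq)         = false , eq
∈-pair⁻ (there (here eq)) = true , eq

core-∈-ends : ∀ {m} {c} s e → c ∈ endNbrs s e → core c ∈ nbrs {m} (side s (level e))
core-∈-ends     s 0F c∈ = ∈-++⁺ˡ (∈-map⁺ inj₁ c∈)
-- Only the `above` half is inspected, so the last level may also be the first.
core-∈-ends {m} s 1F c∈ rewrite view-fromℕ m = ∈-++⁺ʳ (below s (fromℕ m)) (∈-map⁺ inj₁ c∈)

ends-∈-core : ∀ {m} {c} s e → c ∈ endNbrs s e → side s (level e) ∈ nbrs {m} (core c)
ends-∈-core s e c∈ = ∈-map⁺ place (All.lookup (endNbrs-sym s e) c∈)

nbrs-sym : ∀ {m} (u v : Vertex (suc m)) → v ∈ nbrs u → u ∈ nbrs v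
nbrs-sym (core c) v v∈ with ∈-map⁻ place v∈
... | core d   , d∈ , refl = ∈-map⁺ place (All.lookup (coreNbrs-sym c) d∈)
... | side s e , e∈ , refl = core-∈-ends s e (All.lookup (coreNbrs-sym c) e∈)
nbrs-sym {m} (side s i) v v∈ = Sum.[ below-sym i , above-sym (view i) ]′ (∈-++⁻ (below s i) v∈)
  where
  below-sym : ∀ i → v ∈ below s i → side s i ∈ nbrs v
  below-sym zero v∈ with c , c∈ , refl ← ∈-map⁻ inj₁ v∈ = ends-∈-core s 0F c∈
  -- The neighbour sits on level `inject₁ j`; unfolding its view shows that the pair above it is
  -- level `suc j`.
  below-sym (suc j) v∈ with s′ , refl ← ∈-pair⁻ v∈
    rewrite view-inject₁ j = ∈-++⁺ʳ (below s′ (inject₁ j)) (∈-pair s (suc j))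

  above-sym : ∀ {i} (top? : View i) → v ∈ above s top? → side s i ∈ nbrs v
  above-sym ‵fromℕ v∈ with c , c∈ , refl ← ∈-map⁻ inj₁ v∈ = ends-∈-core s 1F c∈
  above-sym (‵inject₁ j) v∈ with s′ , refl ← ∈-pair⁻ v∈ = ∈-++⁺ˡ (∈-pair s (inject₁ j))

-- Absence of loops.

inject₁≢suc : ∀ {n} (i : Fin n) → inject₁ i ≢ suc i
inject₁≢suc i eq = 1+n≢n (sym (trans (sym (toℕ-inject₁ i)) (cong toℕ eq)))

nbrs-irrefl : ∀ {m} (v : Vertex (suc m)) → v ∉ nbrs v
nbrs-irrefl (core c) c∈ with ∈-map⁻ place c∈
... | core .c , c∈′ , refl = coreNbrs-irrefl c c∈′
nbrs-irrefl (side s i) v∈ = Sum.[ below-irrefl i , above-irrefl (view i) ]′ (∈-++⁻ (below s i) v∈)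
  where
  below-irrefl : ∀ {m} (i : Fin (suc m)) → side s i ∉ below s i
  below-irrefl zero v∈ with () ← proj₂ (proj₂ (∈-map⁻ inj₁ v∈))
  below-irrefl (suc j) v∈ =
    inject₁≢suc j (sym (cong proj₂ (Sum.inj₂-injective (proj₂ (∈-pair⁻ v∈)))))

  above-irrefl : ∀ {m} {i : Fin (suc m)} (top? : View i) → side s i ∉ above s top?
  above-irrefl ‵fromℕ v∈ with () ← proj₂ (proj₂ (∈-map⁻ inj₁ v∈))
  above-irrefl (‵inject₁ j) v∈ =
    inject₁≢suc j (cong proj₂ (Sum.inj₂-injective (proj₂ (∈-pair⁻ v∈))))

-- Distinctness of neighbours.

-- Once levels are forgotten, distinctness can be decided independently of `m`, and it carries over
-- even when `place` merges the two levels.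
collapse : ∀ {p} → Vertex p → Fin 15 ⊎ Bool
collapse = Sum.map₂ proj₁

collapsed? : ∀ {p} (vs : List (Vertex p)) → Dec (Unique (map collapse vs))
collapsed? vs = DecUnique.unique? (Sum.≡-dec Fin._≟_ Bool._≟_) (map collapse vs)

collapse⇒unique : ∀ {p} {vs : List (Vertex p)} {_ : True (collapsed? vs)} → Unique vs
collapse⇒unique {_} {_} {vs!} = Unique.map⁻ (toWitness vs!)

collapse-place : ∀ {m} t → collapse (place {m} t) ≡ collapse t
collapse-place (core c)   = refl
collapse-place (side s e) = refl

coreNbrs-unique : ∀ c → Unique (map collapse (coreNbrs c))
coreNbrs-unique = from-yes (all? λ c → collapsed? (coreNbrs c))

-- `collapse` cannot separate two pairs, since only their levels differ.
pairs-unique : ∀ {p} {i j : Fin p} → i ≢ j → Unique (pair i ++ pair j)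
pairs-unique i≢j =
  ((λ ()) ∷ (λ { refl → i≢j refl }) ∷ (λ ()) ∷ []) ∷
  ((λ ()) ∷ (λ { refl → i≢j refl }) ∷ []) ∷
  ((λ ()) ∷ []) ∷ [] ∷ []

-- Separates the two levels adjacent to the inner level `inject₁ (suc i)`.
inject₁²≢suc² : ∀ {n} (i : Fin n) → inject₁ (inject₁ i) ≢ suc (suc i)
inject₁²≢suc² i eq = ℕ.m≢1+n+m (toℕ i) {1} (begin
  toℕ i                     ≡⟨ toℕ-inject₁ i ⟨
  toℕ (inject₁ i)           ≡⟨ toℕ-inject₁ (inject₁ i) ⟨
  toℕ (inject₁ (inject₁ i)) ≡⟨ cong toℕ eq ⟩
  suc (suc (toℕ i))         ∎)
  where open ≡-Reasoning

nbrs-unique : ∀ {m} (v : Vertex (suc m)) → Unique (nbrs v)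
nbrs-unique (core c) = Unique.map⁻ {f = collapse} (subst Unique eq (coreNbrs-unique c))
  where
  eq : map collapse (coreNbrs c) ≡ map collapse (map place (coreNbrs c))
  eq = trans (map-cong (sym ∘ collapse-place) (coreNbrs c)) (map-∘ (coreNbrs c))
nbrs-unique (side s i) = sides s (view i)
  where
  sides : ∀ {m} s {i : Fin (suc m)} (top? : View i) → Unique (below s i ++ above s top?)
  -- The cases go just far enough for the lists to evaluate; `s` must be known on the first level,
  -- where `endNbrs` depends on it.
  sides {zero}  false ‵fromℕ    = collapse⇒unique
  sides {zero}  true  ‵fromℕ    = collapse⇒unique
  sides {suc _} s     ‵fromℕ    = collapse⇒unique
  sides false (‵inject₁ zero)    = collapse⇒unique
  sides true  (‵inject₁ zero)    = collapse⇒unique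
  sides s     (‵inject₁ (suc j)) = pairs-unique (inject₁²≢suc² j)

-- Neighbour sums.

-- place t has label base t + slope t * m.
base slope : Template → ℕ
base (core c)  = 2 + toℕ c
base (low _)   = 1
base (high _)  = 17
slope (core _)  = 1
slope (low 0F)  = 1
slope (low 1F)  = 0
slope (high 0F) = 1
slope (high 1F) = 2

label-place : ∀ {m} t → label (place {m} t) ≡ base t + slope t * m
label-place {m} (core c) = trans (label-core c) (eq m (toℕ c))
  where
  eq : ∀ m c → suc (suc m + c) ≡ 2 + c + 1 * m
  eq = solve-∀
label-place {m} (low 0F) = trans (label-low {m} zero) (cong suc (sym (ℕ.*-identityˡ m)))
label-place {m} (low 1F) = trans (label-low (fromℕ m))
  (cong suc (trans (cong (m ∸_) (toℕ-fromℕ m)) (ℕ.n∸n≡0 m)))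
label-place {m} (high 0F) = trans (label-high {suc m} zero) (eq m)
  where
  eq : ∀ m → suc (suc m + (15 + 0)) ≡ 17 + 1 * m
  eq = solve-∀
label-place {m} (high 1F) =
  trans (label-high (fromℕ m)) (trans (cong (λ i → suc (suc m + (15 + i))) (toℕ-fromℕ m)) (eq m))
  where
  eq : ∀ m → suc (suc m + (15 + m)) ≡ 17 + 2 * m
  eq = solve-∀

place-sum : ∀ {m} ts →
  sum (map label (map (place {m}) ts)) ≡ sum (map base ts) + sum (map slope ts) * m
place-sum     []       = refl
place-sum {m} (t ∷ ts) = trans (cong₂ _+_ (label-place t) (place-sum ts))
  (eq (base t) (sum (map base ts)) (slope t) (sum (map slope ts)) m)
  where
  eq : ∀ b b′ s s′ m → b + s * m + (b′ + s′ * m) ≡ b + b′ + (s + s′) * m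
  eq = solve-∀

-- The required sum 4(t + 1) is 36 + 4m, so comparing coefficients in `m` leaves two finite checks.
coreNbrs-base : ∀ c → sum (map base (coreNbrs c)) ≡ 36
coreNbrs-base = from-yes (all? λ c → sum (map base (coreNbrs c)) ℕ.≟ 36)

coreNbrs-slope : ∀ c → sum (map slope (coreNbrs c)) ≡ 4
coreNbrs-slope = from-yes (all? λ c → sum (map slope (coreNbrs c)) ℕ.≟ 4)

endNbrs-sum : ∀ {m} s e → sum (map (label {suc m}) (map inj₁ (endNbrs s e))) ≡ 18 + 2 * m
-- `place` fixes core vertices, and the base and slope sums of each antipodal pair evaluate to 18
-- and 2.
endNbrs-sum false 0F = place-sum (map inj₁ (endNbrs false 0F))
endNbrs-sum true  0F = place-sum (map inj₁ (endNbrs true 0F))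
endNbrs-sum s     1F = place-sum (map inj₁ (endNbrs s 1F))

nbrs-sum : ∀ {m} (v : Vertex (suc m)) → sum (map label (nbrs v)) ≡ 36 + 4 * m
nbrs-sum {m} (core c) = trans (place-sum (coreNbrs c))
  (cong₂ (λ b s → b + s * m) (coreNbrs-base c) (coreNbrs-slope c))
nbrs-sum {m} (side s i) = begin
  sum (map label (below s i ++ above s (view i)))
    ≡⟨ cong sum (map-++ label (below s i) _) ⟩
  sum (map label (below s i) ++ map label (above s (view i)))
    ≡⟨ sum-++ (map label (below s i)) _ ⟩
  sum (map label (below s i)) + sum (map label (above s (view i)))
    ≡⟨ cong₂ _+_ (below-sum i) (above-sum (view i)) ⟩
  18 + 2 * m + (18 + 2 * m)
    ≡⟨ eq m ⟩
  36 + 4 * m ∎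
  where
  open ≡-Reasoning

  below-sum : ∀ i → sum (map label (below {m} s i)) ≡ 18 + 2 * m
  below-sum zero    = endNbrs-sum s 0F
  below-sum (suc i) = pair-sum (inject₁ i)

  above-sum : ∀ {i} (top? : View i) → sum (map label (above {m} s top?)) ≡ 18 + 2 * m
  above-sum ‵fromℕ       = endNbrs-sum s 1F
  above-sum (‵inject₁ i) = pair-sum (suc i)

  eq : ∀ m → 18 + 2 * m + (18 + 2 * m) ≡ 36 + 4 * m
  eq = solve-∀

theorem2p7 : ∀ (t : ℕ) → t ≥ 8 → IsMagicConstant (4 * t + 4)
theorem2p7 t t≥8 with m , refl ← m≤n⇒∃[o]m+o≡n t≥8 =
  -- With t = 8 + m there are t - 7 = m + 1 levels; t ≥ 8 makes the chain nonempty.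
  subst IsMagicConstant (eq m)
    (neighbourLists⇒magic (byLabel (suc m)) nbrs z<s z<s
      nbrs-unique nbrs-sym nbrs-irrefl nbrs-sum)
  where
  eq : ∀ m → 36 + 4 * m ≡ 4 * (8 + m) + 4
  eq = solve-∀
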